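{- Let $U$ be any consistent theory in the language of arithmetic that extends the Tarski–Mostowski–Robinson theory $\mathsf{R}$ (no restriction is placed on the complexity of the axiom set of $U$). Then there is no formula $\rho(x)$ (of any complexity) satisfying both of the following: (Independence) for every sentence $\phi$, if $U+\phi$ is consistent, then both $U+\phi+\rho(\ulcorner\phi\urcorner)$ and $U+\phi+\neg\rho(\ulcorner\phi\urcorner)$ are consistent; (Extensionality) for all sentences $\phi,\psi$, if $U\vdash\phi\leftrightarrow\psi$, then $U\vdash\rho(\ulcorner\phi\urcorner)\leftrightarrow\rho(\ulcorner\psi\urcorner)$.
   Context: $\ulcorner\phi\urcorner$ denotes the numeral of the Gödel number of $\phi$ under a standard Gödel numbering. A formula satisfying Independence and Extensionality over $U$ is called an extensional Rosser formula over $U$. -}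

module Defs where

open import Data.Nat using (ℕ; zero; suc; _+_; _*_; _^_)
open import Data.Fin using (Fin; zero; suc; toℕ)
open import Data.Sum using (_⊎_)
open import Data.Product using (Σ; _×_)
open import Relation.Binary.PropositionalEquality using (_≡_)
open import Relation.Nullary using (¬_)

data Term (n : ℕ) : Set where
  var  : Fin n → Term n
  `0   : Term n
  `S   : Term n → Term n
  _`+_ : Term n → Term n → Term n
  _`*_ : Term n → Term n → Term n

infix  7 _==_
infixr 5 _⇒_

data Formula (n : ℕ) : Set where
  ⊥'   : Formula n
  _==_ : Term n → Term n → Formula n
  _⇒_  : Formula n → Formula n → Formula n
  ∀'   : Formula (suc n) → Formula n

Sentence : Set
Sentence = Formula 0

¬' : ∀ {n} → Formula n → Formula n
¬' φ = φ ⇒ ⊥'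

_∨'_ : ∀ {n} → Formula n → Formula n → Formula n
φ ∨' ψ = ¬' φ ⇒ ψ

_∧'_ : ∀ {n} → Formula n → Formula n → Formula n
φ ∧' ψ = ¬' (φ ⇒ ¬' ψ)

_⇔_ : ∀ {n} → Formula n → Formula n → Formula n
φ ⇔ ψ = (φ ⇒ ψ) ∧' (ψ ⇒ φ)

∃' : ∀ {n} → Formula (suc n) → Formula n
∃' φ = ¬' (∀' (¬' φ))

Ren : ℕ → ℕ → Set
Ren n m = Fin n → Fin m

extR : ∀ {n m} → Ren n m → Ren (suc n) (suc m)
extR ρ zero    = zero
extR ρ (suc i) = suc (ρ i)

renT : ∀ {n m} → Ren n m → Term n → Term m
renT ρ (var i)  = var (ρ i)
renT ρ `0       = `0
renT ρ (`S t)   = `S (renT ρ t)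
renT ρ (s `+ t) = renT ρ s `+ renT ρ t
renT ρ (s `* t) = renT ρ s `* renT ρ t

renF : ∀ {n m} → Ren n m → Formula n → Formula m
renF ρ ⊥'       = ⊥'
renF ρ (s == t) = renT ρ s == renT ρ t
renF ρ (φ ⇒ ψ)  = renF ρ φ ⇒ renF ρ ψ
renF ρ (∀' φ)   = ∀' (renF (extR ρ) φ)

Sub : ℕ → ℕ → Set
Sub n m = Fin n → Term m

extS : ∀ {n m} → Sub n m → Sub (suc n) (suc m)
extS σ zero    = var zero
extS σ (suc i) = renT suc (σ i)

subT : ∀ {n m} → Sub n m → Term n → Term m
subT σ (var i)  = σ i
subT σ `0       = `0
subT σ (`S t)   = `S (subT σ t)
subT σ (s `+ t) = subT σ s `+ subT σ t
subT σ (s `* t) = subT σ s `* subT σ t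

subF : ∀ {n m} → Sub n m → Formula n → Formula m
subF σ ⊥'       = ⊥'
subF σ (s == t) = subT σ s == subT σ t
subF σ (φ ⇒ ψ)  = subF σ φ ⇒ subF σ ψ
subF σ (∀' φ)   = ∀' (subF (extS σ) φ)

sub0 : ∀ {n} → Term n → Sub (suc n) n
sub0 t zero    = t
sub0 t (suc i) = var i

_[_] : ∀ {n} → Formula (suc n) → Term n → Formula n
φ [ t ] = subF (sub0 t) φ

wkT : ∀ {n} → Term n → Term (suc n)
wkT = renT suc

wkF : ∀ {n} → Formula n → Formula (suc n)
wkF = renF suc

emptyR : ∀ {n} → Ren 0 n
emptyR ()

liftS : ∀ {n} → Sentence → Formula n
liftS = renF emptyR

num : ∀ {n} → ℕ → Term n
num zero    = `0
num (suc k) = `S (num k)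

pair : ℕ → ℕ → ℕ
pair a b = 2 ^ a * (1 + 2 * b)

codeT : ∀ {n} → Term n → ℕ
codeT (var i)  = pair 0 (toℕ i)
codeT `0       = pair 1 0
codeT (`S t)   = pair 2 (codeT t)
codeT (s `+ t) = pair 3 (pair (codeT s) (codeT t))
codeT (s `* t) = pair 4 (pair (codeT s) (codeT t))

codeF : ∀ {n} → Formula n → ℕ
codeF ⊥'       = pair 0 0
codeF (s == t) = pair 1 (pair (codeT s) (codeT t))
codeF (φ ⇒ ψ)  = pair 2 (pair (codeF φ) (codeF ψ))
codeF (∀' φ)   = pair 3 (codeF φ)

⌜_⌝ : ∀ {n} → Sentence → Term n
⌜ φ ⌝ = num (codeF φ)

_⟨_⟩ : Formula 1 → Sentence → Sentence
ρ ⟨ φ ⟩ = ρ [ ⌜ φ ⌝ ]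

Theory : Set₁
Theory = Sentence → Set

infix 3 _⊢_

data _⊢_ (T : Theory) : ∀ {n} → Formula n → Set where
  ax    : ∀ {n} {ψ : Sentence} → T ψ → T ⊢ liftS {n} ψ
  mp    : ∀ {n} {φ ψ : Formula n} → T ⊢ φ ⇒ ψ → T ⊢ φ → T ⊢ ψ
  axK   : ∀ {n} {φ ψ : Formula n} → T ⊢ φ ⇒ ψ ⇒ φ
  axS   : ∀ {n} {φ ψ χ : Formula n} →
          T ⊢ (φ ⇒ ψ ⇒ χ) ⇒ (φ ⇒ ψ) ⇒ φ ⇒ χ
  axDNE : ∀ {n} {φ : Formula n} → T ⊢ ¬' (¬' φ) ⇒ φ
  gen   : ∀ {n} {φ : Formula (suc n)} → T ⊢ φ → T ⊢ ∀' φ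
  ∀elim : ∀ {n} {φ : Formula (suc n)} (t : Term n) → T ⊢ ∀' φ ⇒ φ [ t ]
  ∀dist : ∀ {n} {ψ : Formula n} {φ : Formula (suc n)} →
          T ⊢ ∀' (wkF ψ ⇒ φ) ⇒ ψ ⇒ ∀' φ
  eqRefl : ∀ {n} (t : Term n) → T ⊢ t == t
  eqSubst : ∀ {n} (s t : Term n) (φ : Formula (suc n)) →
            T ⊢ s == t ⇒ φ [ s ] ⇒ φ [ t ]

Consistent : Theory → Set
Consistent T = ¬ (T ⊢ ⊥' {0})

_+ₜ_ : Theory → Sentence → Theory
(T +ₜ φ) ψ = T ψ ⊎ ψ ≡ φ

_≤'_ : ∀ {n} → Term n → Term n → Formula n
s ≤' t = ∃' ((var zero `+ wkT s) == wkT t)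

upToDisj : ℕ → Formula 1
upToDisj zero    = var zero == num 0
upToDisj (suc k) = upToDisj k ∨' (var zero == num (suc k))

data R : Theory where
  R1 : ∀ m k → R (num m `+ num k == num (m + k))
  R2 : ∀ m k → R (num m `* num k == num (m * k))
  R3 : ∀ m k → ¬ (m ≡ k) → R (¬' (num m == num k))
  R4 : ∀ k → R (∀' ((var zero ≤' num k) ⇒ upToDisj k))
  R5 : ∀ k → R (∀' ((var zero ≤' num k) ∨' (num k ≤' var zero)))

Extends-R : Theory → Set
Extends-R U = ∀ ψ → R ψ → U ⊢ ψ

Independence : Theory → Formula 1 → Set
Independence U ρ = ∀ (φ : Sentence) → Consistent (U +ₜ φ) →
  Consistent ((U +ₜ φ) +ₜ (ρ ⟨ φ ⟩)) × Consistent ((U +ₜ φ) +ₜ ¬' (ρ ⟨ φ ⟩))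

Extensionality : Theory → Formula 1 → Set
Extensionality U ρ = ∀ (φ ψ : Sentence) → U ⊢ φ ⇔ ψ →
  U ⊢ (ρ ⟨ φ ⟩) ⇔ (ρ ⟨ ψ ⟩)

{-# OPTIONS --safe #-}
-- For every formula A(x) there is a sentence γ with U ⊢ γ ↔ A(⌜γ⌝). A fixed
-- point φ of ρ satisfies U + φ ⊢ ρ(⌜φ⌝), so Independence makes U + φ
-- inconsistent; hence U ⊢ φ ↔ ⊥ and, by Extensionality, U ⊢ ¬ρ(⌜⊥⌝). A fixed
-- point of ¬ρ gives U ⊢ ρ(⌜⊥⌝) in the same way.
--
-- The diagonal lemma is obtained without representing exponentiation in U. The
-- context C[φ] = ∀x (x = t ⇒ φ) defines x as t in φ, and its code is an affine
-- function of the code of φ. Hence m nested copies of a fixed "layer" of such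
-- definitions around a core of code c have code (1+d)ᵐ c + κ gₘ, with
-- gₘ = 1 + (1+d) + … + (1+d)ᵐ⁻¹, for constants d and κ. The layers themselves
-- compute d, gₘ and m in three variables, so taking m = c the core can express
-- the code of the whole sentence by a term in these variables.
module Submission where

open import Defs
open import Data.Fin using (Fin; zero; suc; toℕ; _↑ˡ_)
open import Data.Fin.Properties using (toℕ-↑ˡ)
open import Data.Nat using (ℕ; zero; suc; pred; _+_; _*_; _^_)
open import Data.Nat.Properties using (+-identityʳ; +-suc; m^n≢0; suc-pred)
open import Data.Nat.Tactic.RingSolver using (solve-∀)
open import Data.Product using (Σ; _×_; _,_; ∃₂; proj₁; proj₂)
open import Data.Sum using (inj₁; inj₂)
open import Function using (_∘_)
open import Relation.Binary.PropositionalEquality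
  using (_≡_; refl; sym; trans; cong; cong₂; subst; subst₂; module ≡-Reasoning)
open import Relation.Nullary using (¬_)

private variable
  k l n : ℕ
  T U : Theory

-- Substitution

subT-cong : {σ τ : Sub n l} → (∀ i → σ i ≡ τ i) → ∀ t → subT σ t ≡ subT τ t
subT-cong e (var i)  = e i
subT-cong e `0       = refl
subT-cong e (`S t)   = cong `S (subT-cong e t)
subT-cong e (s `+ t) = cong₂ _`+_ (subT-cong e s) (subT-cong e t)
subT-cong e (s `* t) = cong₂ _`*_ (subT-cong e s) (subT-cong e t)

extS-cong : {σ τ : Sub n l} → (∀ i → σ i ≡ τ i) → ∀ i → extS σ i ≡ extS τ i
extS-cong e zero    = refl
extS-cong e (suc i) = cong wkT (e i)

subF-cong : {σ τ : Sub n l} → (∀ i → σ i ≡ τ i) → ∀ φ → subF σ φ ≡ subF τ φ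
subF-cong e ⊥'       = refl
subF-cong e (s == t) = cong₂ _==_ (subT-cong e s) (subT-cong e t)
subF-cong e (φ ⇒ ψ)  = cong₂ _⇒_ (subF-cong e φ) (subF-cong e ψ)
subF-cong e (∀' φ)   = cong ∀' (subF-cong (extS-cong e) φ)

subT-id : (t : Term n) → subT var t ≡ t
subT-id (var i)  = refl
subT-id `0       = refl
subT-id (`S t)   = cong `S (subT-id t)
subT-id (s `+ t) = cong₂ _`+_ (subT-id s) (subT-id t)
subT-id (s `* t) = cong₂ _`*_ (subT-id s) (subT-id t)

extS-var : (i : Fin (suc n)) → extS var i ≡ var i
extS-var zero    = refl
extS-var (suc i) = refl

subF-id : (φ : Formula n) → subF var φ ≡ φ
subF-id ⊥'       = refl
subF-id (s == t) = cong₂ _==_ (subT-id s) (subT-id t)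
subF-id (φ ⇒ ψ)  = cong₂ _⇒_ (subF-id φ) (subF-id ψ)
subF-id (∀' φ)   = cong ∀' (trans (subF-cong extS-var φ) (subF-id φ))

renT-as-subT : (ρ : Ren n l) (t : Term n) → renT ρ t ≡ subT (var ∘ ρ) t
renT-as-subT ρ (var i)  = refl
renT-as-subT ρ `0       = refl
renT-as-subT ρ (`S t)   = cong `S (renT-as-subT ρ t)
renT-as-subT ρ (s `+ t) = cong₂ _`+_ (renT-as-subT ρ s) (renT-as-subT ρ t)
renT-as-subT ρ (s `* t) = cong₂ _`*_ (renT-as-subT ρ s) (renT-as-subT ρ t)

extR-extS : (ρ : Ren n l) (i : Fin (suc n)) → var (extR ρ i) ≡ extS (var ∘ ρ) i
extR-extS ρ zero    = refl
extR-extS ρ (suc i) = refl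

renF-as-subF : (ρ : Ren n l) (φ : Formula n) → renF ρ φ ≡ subF (var ∘ ρ) φ
renF-as-subF ρ ⊥'       = refl
renF-as-subF ρ (s == t) = cong₂ _==_ (renT-as-subT ρ s) (renT-as-subT ρ t)
renF-as-subF ρ (φ ⇒ ψ)  = cong₂ _⇒_ (renF-as-subF ρ φ) (renF-as-subF ρ ψ)
renF-as-subF ρ (∀' φ)   =
  cong ∀' (trans (renF-as-subF (extR ρ) φ) (subF-cong (extR-extS ρ) φ))

subT-renT : (σ : Sub l k) (ρ : Ren n l) (t : Term n) →
            subT σ (renT ρ t) ≡ subT (σ ∘ ρ) t
subT-renT σ ρ (var i)  = refl
subT-renT σ ρ `0       = refl
subT-renT σ ρ (`S t)   = cong `S (subT-renT σ ρ t)
subT-renT σ ρ (s `+ t) = cong₂ _`+_ (subT-renT σ ρ s) (subT-renT σ ρ t)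
subT-renT σ ρ (s `* t) = cong₂ _`*_ (subT-renT σ ρ s) (subT-renT σ ρ t)

extS-extR : (σ : Sub l k) (ρ : Ren n l) (i : Fin (suc n)) →
            extS σ (extR ρ i) ≡ extS (σ ∘ ρ) i
extS-extR σ ρ zero    = refl
extS-extR σ ρ (suc i) = refl

subF-renF : (σ : Sub l k) (ρ : Ren n l) (φ : Formula n) →
            subF σ (renF ρ φ) ≡ subF (σ ∘ ρ) φ
subF-renF σ ρ ⊥'       = refl
subF-renF σ ρ (s == t) = cong₂ _==_ (subT-renT σ ρ s) (subT-renT σ ρ t)
subF-renF σ ρ (φ ⇒ ψ)  = cong₂ _⇒_ (subF-renF σ ρ φ) (subF-renF σ ρ ψ)
subF-renF σ ρ (∀' φ)   =
  cong ∀' (trans (subF-renF (extS σ) (extR ρ) φ) (subF-cong (extS-extR σ ρ) φ))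

subT-subT : (τ : Sub l k) (σ : Sub n l) (t : Term n) →
            subT τ (subT σ t) ≡ subT (subT τ ∘ σ) t
subT-subT τ σ (var i)  = refl
subT-subT τ σ `0       = refl
subT-subT τ σ (`S t)   = cong `S (subT-subT τ σ t)
subT-subT τ σ (s `+ t) = cong₂ _`+_ (subT-subT τ σ s) (subT-subT τ σ t)
subT-subT τ σ (s `* t) = cong₂ _`*_ (subT-subT τ σ s) (subT-subT τ σ t)

wkT-subT : (σ : Sub n l) (t : Term n) → wkT (subT σ t) ≡ subT (wkT ∘ σ) t
wkT-subT σ t = begin
  wkT (subT σ t)                  ≡⟨ renT-as-subT suc (subT σ t) ⟩
  subT (var ∘ suc) (subT σ t)     ≡⟨ subT-subT (var ∘ suc) σ t ⟩
  subT (subT (var ∘ suc) ∘ σ) t   ≡⟨ subT-cong (λ i → sym (renT-as-subT suc (σ i))) t ⟩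
  subT (wkT ∘ σ) t                ∎
  where open ≡-Reasoning

subT-wkT : (σ : Sub n l) (t : Term n) → subT (extS σ) (wkT t) ≡ wkT (subT σ t)
subT-wkT σ t = trans (subT-renT (extS σ) suc t) (sym (wkT-subT σ t))

extS-∘ : (τ : Sub l k) (σ : Sub n l) (i : Fin (suc n)) →
         subT (extS τ) (extS σ i) ≡ extS (subT τ ∘ σ) i
extS-∘ τ σ zero    = refl
extS-∘ τ σ (suc i) = subT-wkT τ (σ i)

subF-subF : (τ : Sub l k) (σ : Sub n l) (φ : Formula n) →
            subF τ (subF σ φ) ≡ subF (subT τ ∘ σ) φ
subF-subF τ σ ⊥'       = refl
subF-subF τ σ (s == t) = cong₂ _==_ (subT-subT τ σ s) (subT-subT τ σ t)
subF-subF τ σ (φ ⇒ ψ)  = cong₂ _⇒_ (subF-subF τ σ φ) (subF-subF τ σ ψ)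
subF-subF τ σ (∀' φ)   =
  cong ∀' (trans (subF-subF (extS τ) (extS σ) φ) (subF-cong (extS-∘ τ σ) φ))

subT-sub0-wkT : (s t : Term n) → subT (sub0 s) (wkT t) ≡ t
subT-sub0-wkT s t = trans (subT-renT (sub0 s) suc t) (subT-id t)

infixr 5 _◂_

_◂_ : Term l → Sub n l → Sub (suc n) l
(t ◂ σ) zero    = t
(t ◂ σ) (suc i) = σ i

subF-extS-sub0 : (σ : Sub n l) (t : Term l) (φ : Formula (suc n)) →
                 subF (extS σ) φ [ t ] ≡ subF (t ◂ σ) φ
subF-extS-sub0 σ t φ =
  trans (subF-subF (sub0 t) (extS σ) φ)
        (subF-cong (λ { zero → refl ; (suc i) → subT-sub0-wkT t (σ i) }) φ)

-- With `extR-suc-[]`, this lets `eqSubst` replace `wkT t` by the bound variable under the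
-- quantifier of `define`.
wkF-[] : (φ : Formula (suc n)) (t : Term n) →
         renF (extR suc) φ [ wkT t ] ≡ wkF (φ [ t ])
wkF-[] φ t = begin
  renF (extR suc) φ [ wkT t ]
    ≡⟨ subF-renF (sub0 (wkT t)) (extR suc) φ ⟩
  subF (sub0 (wkT t) ∘ extR suc) φ
    ≡⟨ subF-cong (λ { zero → renT-as-subT suc t ; (suc i) → refl }) φ ⟩
  subF (subT (var ∘ suc) ∘ sub0 t) φ
    ≡⟨ sym (subF-subF (var ∘ suc) (sub0 t) φ) ⟩
  subF (var ∘ suc) (φ [ t ])
    ≡⟨ sym (renF-as-subF suc (φ [ t ])) ⟩
  wkF (φ [ t ]) ∎
  where open ≡-Reasoning

extR-suc-[] : (φ : Formula (suc n)) → renF (extR suc) φ [ var zero ] ≡ φ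
extR-suc-[] φ =
  trans (subF-renF (sub0 (var zero)) (extR suc) φ)
        (trans (subF-cong (λ { zero → refl ; (suc i) → refl }) φ) (subF-id φ))

liftS-id : (φ : Sentence) → liftS φ ≡ φ
liftS-id φ = trans (renF-as-subF emptyR φ) (trans (subF-cong (λ ()) φ) (subF-id φ))

wkF-liftS : (φ : Sentence) → wkF (liftS {n} φ) ≡ liftS φ
wkF-liftS φ = begin
  wkF (liftS φ)                    ≡⟨ renF-as-subF suc (liftS φ) ⟩
  subF (var ∘ suc) (liftS φ)       ≡⟨ subF-renF (var ∘ suc) emptyR φ ⟩
  subF (var ∘ suc ∘ emptyR) φ      ≡⟨ subF-cong (λ ()) φ ⟩
  subF (var ∘ emptyR) φ            ≡⟨ sym (renF-as-subF emptyR φ) ⟩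
  liftS φ                          ∎
  where open ≡-Reasoning

-- Derivations

module _ {T : Theory} {n : ℕ} where

  ⇒-const : {φ ψ : Formula n} → T ⊢ ψ → T ⊢ φ ⇒ ψ
  ⇒-const p = mp axK p

  ⇒-ap : {φ ψ χ : Formula n} → T ⊢ φ ⇒ ψ ⇒ χ → T ⊢ φ ⇒ ψ → T ⊢ φ ⇒ χ
  ⇒-ap p q = mp (mp axS p) q

  ⇒-id : {φ : Formula n} → T ⊢ φ ⇒ φ
  ⇒-id {φ} = ⇒-ap {ψ = φ ⇒ φ} axK axK

  ⇒-trans : {φ ψ χ : Formula n} → T ⊢ φ ⇒ ψ → T ⊢ ψ ⇒ χ → T ⊢ φ ⇒ χ
  ⇒-trans p q = ⇒-ap (⇒-const q) p

  ⇒-flip : {φ ψ χ : Formula n} → T ⊢ φ ⇒ ψ ⇒ χ → T ⊢ ψ ⇒ φ ⇒ χ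
  ⇒-flip p = ⇒-trans axK (mp axS p)

  exfalso : {φ : Formula n} → T ⊢ ⊥' ⇒ φ
  exfalso = ⇒-trans axK axDNE

  ∧-intro : {φ ψ : Formula n} → T ⊢ φ → T ⊢ ψ → T ⊢ φ ∧' ψ
  ∧-intro p q = ⇒-ap (⇒-ap ⇒-id (⇒-const p)) (⇒-const q)

  ∧-elimˡ : {φ ψ : Formula n} → T ⊢ φ ∧' ψ → T ⊢ φ
  -- From `¬' φ`, ex falso gives `φ ⇒ ¬' ψ`, which `p` refutes.
  ∧-elimˡ p = mp axDNE (⇒-trans (⇒-flip (⇒-trans (⇒-flip ⇒-id) (mp axS (⇒-const exfalso)))) p)

  ∧-elimʳ : {φ ψ : Formula n} → T ⊢ φ ∧' ψ → T ⊢ ψ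
  ∧-elimʳ p = mp axDNE (⇒-trans axK p)

infix 3 _⊢_≃_

_⊢_≃_ : Theory → Formula n → Formula n → Set
T ⊢ φ ≃ ψ = (T ⊢ φ ⇒ ψ) × (T ⊢ ψ ⇒ φ)

≃-trans : {φ ψ χ : Formula n} → T ⊢ φ ≃ ψ → T ⊢ ψ ≃ χ → T ⊢ φ ≃ χ
≃-trans (p , p′) (q , q′) = ⇒-trans p q , ⇒-trans q′ p′

weaken : {φ : Formula n} → (∀ {ψ} → T ψ → U ψ) → T ⊢ φ → U ⊢ φ
weaken f (ax a)          = ax (f a)
weaken f (mp p q)        = mp (weaken f p) (weaken f q)
weaken f axK             = axK
weaken f axS             = axS
weaken f axDNE           = axDNE
weaken f (gen p)         = gen (weaken f p)
weaken f (∀elim t)       = ∀elim t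
weaken f ∀dist           = ∀dist
weaken f (eqRefl t)      = eqRefl t
weaken f (eqSubst s t φ) = eqSubst s t φ

deduction : {φ : Sentence} {ψ : Formula n} → (T +ₜ φ) ⊢ ψ → T ⊢ liftS φ ⇒ ψ
deduction (ax (inj₁ a))    = ⇒-const (ax a)
deduction (ax (inj₂ refl)) = ⇒-id
deduction (mp p q)         = ⇒-ap (deduction p) (deduction q)
deduction axK              = ⇒-const axK
deduction axS              = ⇒-const axS
deduction axDNE            = ⇒-const axDNE
deduction {φ = φ} (gen {φ = χ} p) =
  -- Since `φ` is a sentence, weakening its lift gives a lift again, so `∀dist` applies.
  mp ∀dist (gen (subst (λ α → _ ⊢ α ⇒ χ) (sym (wkF-liftS φ)) (deduction p)))
deduction (∀elim t)        = ⇒-const (∀elim t)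
deduction ∀dist            = ⇒-const ∀dist
deduction (eqRefl t)       = ⇒-const (eqRefl t)
deduction (eqSubst s t φ)  = ⇒-const (eqSubst s t φ)

assume : (T : Theory) (φ : Sentence) → (T +ₜ φ) ⊢ φ
assume T φ = subst ((T +ₜ φ) ⊢_) (liftS-id φ) (ax (inj₂ refl))

refute : {φ : Sentence} → (T +ₜ φ) ⊢ ⊥' → T ⊢ ¬' φ
refute {T = T} {φ} p = subst (λ α → T ⊢ ¬' α) (liftS-id φ) (deduction p)

refute-≃⊥ : {φ : Sentence} → T ⊢ ¬' φ → T ⊢ φ ⇔ ⊥'
refute-≃⊥ p = ∧-intro p exfalso

-- Equality

-- Leibniz's law for the formula `wkT u[s] == u`, whose left side stays fixed, starting from
-- reflexivity.
cong-subT : {s t : Term n} (u : Term (suc n)) → T ⊢ s == t →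
            T ⊢ subT (sub0 s) u == subT (sub0 t) u
cong-subT {T = T} {s = s} {t} u p =
  subst (λ v → T ⊢ v == subT (sub0 t) u) (subT-sub0-wkT t u[s])
    (mp (mp (eqSubst s t (wkT u[s] == u)) p)
        (subst (λ v → T ⊢ v == u[s]) (sym (subT-sub0-wkT s u[s])) (eqRefl u[s])))
  where u[s] = subT (sub0 s) u

==-sym : {s t : Term n} → T ⊢ s == t ⇒ t == s
==-sym {T = T} {s = s} {t} =
  ⇒-ap (subst₂ (λ u v → T ⊢ s == t ⇒ s == u ⇒ t == v)
          (subT-sub0-wkT s s) (subT-sub0-wkT t s)
          (eqSubst s t (var zero == wkT s)))
       (⇒-const (eqRefl s))

==-trans : {s t u : Term n} → T ⊢ s == t → T ⊢ t == u → T ⊢ s == u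
==-trans {T = T} {s = s} {t} {u} p q =
  subst (λ v → T ⊢ v == u) (subT-sub0-wkT u s)
    (mp (mp (eqSubst t u (wkT s == var zero)) q)
        (subst (λ v → T ⊢ v == t) (sym (subT-sub0-wkT t s)) p))

cong-`+ : {s s′ t t′ : Term n} → T ⊢ s == s′ → T ⊢ t == t′ → T ⊢ s `+ t == s′ `+ t′
cong-`+ {T = T} {s = s} {s′} {t} {t′} p q = ==-trans
  (subst₂ (λ u v → T ⊢ s `+ u == s′ `+ v) (subT-sub0-wkT s t) (subT-sub0-wkT s′ t)
    (cong-subT (var zero `+ wkT t) p))
  (subst₂ (λ u v → T ⊢ u `+ t == v `+ t′) (subT-sub0-wkT t s′) (subT-sub0-wkT t′ s′)
    (cong-subT (wkT s′ `+ var zero) q))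

cong-`* : {s s′ t t′ : Term n} → T ⊢ s == s′ → T ⊢ t == t′ → T ⊢ s `* t == s′ `* t′
cong-`* {T = T} {s = s} {s′} {t} {t′} p q = ==-trans
  (subst₂ (λ u v → T ⊢ s `* u == s′ `* v) (subT-sub0-wkT s t) (subT-sub0-wkT s′ t)
    (cong-subT (var zero `* wkT t) p))
  (subst₂ (λ u v → T ⊢ u `* t == v `* t′) (subT-sub0-wkT t s′) (subT-sub0-wkT t′ s′)
    (cong-subT (wkT s′ `* var zero) q))

leibniz : {s t : Term n} (φ : Formula (suc n)) → T ⊢ s == t → T ⊢ φ [ s ] ≃ φ [ t ]
leibniz {s = s} {t} φ p =
  mp (eqSubst s t φ) p , mp (eqSubst t s φ) (mp ==-sym p)

-- Evaluation of closed terms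

eval : (Fin n → ℕ) → Term n → ℕ
eval η (var i)  = η i
eval η `0       = 0
eval η (`S t)   = suc (eval η t)
eval η (s `+ t) = eval η s + eval η t
eval η (s `* t) = eval η s * eval η t

value : Term 0 → ℕ
value = eval λ ()

eval-num : (η : Fin n → ℕ) (k : ℕ) → eval η (num k) ≡ k
eval-num η zero    = refl
eval-num η (suc k) = cong suc (eval-num η k)

value-subT : (σ : Sub n 0) (t : Term n) → value (subT σ t) ≡ eval (value ∘ σ) t
value-subT σ (var i)  = refl
value-subT σ `0       = refl
value-subT σ (`S t)   = cong suc (value-subT σ t)
value-subT σ (s `+ t) = cong₂ _+_ (value-subT σ s) (value-subT σ t)
value-subT σ (s `* t) = cong₂ _*_ (value-subT σ s) (value-subT σ t)

==-value : Extends-R U → (t : Term 0) → U ⊢ t == num (value t)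
==-value r `0       = eqRefl `0
==-value r (`S t)   = cong-subT (`S (var zero)) (==-value r t)
==-value r (s `+ t) =
  ==-trans (cong-`+ (==-value r s) (==-value r t)) (r _ (R1 (value s) (value t)))
==-value r (s `* t) =
  ==-trans (cong-`* (==-value r s) (==-value r t)) (r _ (R2 (value s) (value t)))

-- Explicit definitions

-- Opaque, lest Agda evaluate the codes of definitions, which are towers of powers of 2.
opaque
  define : Term n → Formula (suc n) → Formula n
  define t φ = ∀' (var zero == wkT t ⇒ φ)

  define-≃ : (t : Term n) (φ : Formula (suc n)) → T ⊢ define t φ ≃ φ [ t ]
  define-≃ {T = T} t φ =
      ⇒-ap (subst (λ u → T ⊢ define t φ ⇒ t == u ⇒ φ [ t ]) (subT-sub0-wkT t t) (∀elim t))
           (⇒-const (eqRefl t))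
    , mp ∀dist (gen (⇒-flip (⇒-trans ==-sym
        (subst₂ (λ α β → T ⊢ wkT t == var zero ⇒ α ⇒ β) (wkF-[] φ t) (extR-suc-[] φ)
          (eqSubst (wkT t) (var zero) (renF (extR suc) φ))))))

  -- Provably, a definition acts like an assignment: it extends the environment `σ` by the value of
  -- `t`. Nested definitions can thus be executed one by one.
  subF-define-≃ : (σ : Sub n l) (t : Term n) (φ : Formula (suc n)) →
                  T ⊢ subF σ (define t φ) ≃ subF (subT σ t ◂ σ) φ
  subF-define-≃ {T = T} σ t φ =
    subst₂ (T ⊢_≃_)
      (cong (λ u → ∀' (var zero == u ⇒ subF (extS σ) φ)) (sym (subT-wkT σ t)))
      (subF-extS-sub0 σ (subT σ t) φ)
      (define-≃ (subT σ t) (subF (extS σ) φ))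

-- Codes

opaque
  unfolding define

  -- The leading coefficient is stored as its predecessor, so that a power of `suc d` can be written
  -- `suc (d * g)` with a geometric sum `g`.
  Affine : (ℕ → ℕ) → Set
  Affine f = ∃₂ λ a b → ∀ c → f c ≡ suc a * c + b

  slope offset : {f : ℕ → ℕ} → Affine f → ℕ
  slope  = proj₁
  offset = proj₁ ∘ proj₂

  affine-eq : {f : ℕ → ℕ} (p : Affine f) → ∀ c → f c ≡ suc (slope p) * c + offset p
  affine-eq = proj₂ ∘ proj₂

  Affine-∘ : {f g : ℕ → ℕ} → Affine f → Affine g → Affine (f ∘ g)
  Affine-∘ {f} {g} (a , b , p) (a′ , b′ , q) =
    a′ + a * suc a′ , suc a * b′ + b , λ c → begin
      f (g c)                                        ≡⟨ p (g c) ⟩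
      suc a * g c + b                                ≡⟨ cong (λ x → suc a * x + b) (q c) ⟩
      suc a * (suc a′ * c + b′) + b                  ≡⟨ expand a b a′ b′ c ⟩
      suc (a′ + a * suc a′) * c + (suc a * b′ + b)   ∎
    where
    open ≡-Reasoning
    expand : ∀ a b a′ b′ c → suc a * (suc a′ * c + b′) + b
                           ≡ suc (a′ + a * suc a′) * c + (suc a * b′ + b)
    expand = solve-∀

  -- The leading coefficient `2 ^ suc k` is nonzero, hence the successor of its predecessor.
  pair-affine : ∀ k → Affine (pair k)
  pair-affine k = pred (2 ^ suc k) , 2 ^ k , λ c →
    trans (expand (2 ^ k) c)
          (cong (λ x → x * c + 2 ^ k) (sym (suc-pred (2 ^ suc k) {{m^n≢0 2 (suc k)}})))
    where
    expand : ∀ p c → p * (1 + 2 * c) ≡ 2 * p * c + p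
    expand = solve-∀

  -- The hole `c` is the second component of every pair on the path to it, so this is a composite of
  -- maps `pair k` with fixed `k`.
  defineCode : ℕ → ℕ → ℕ
  defineCode k c = pair 3 (pair 2 (pair (pair 1 (pair (pair 0 0) k)) c))

  codeF-define : (t : Term n) (φ : Formula (suc n)) →
                 codeF (define t φ) ≡ defineCode (codeT (wkT t)) (codeF φ)
  codeF-define t φ = refl

  defineCode-affine : ∀ k → Affine (defineCode k)
  defineCode-affine k =
    Affine-∘ (pair-affine 3)
      (Affine-∘ (pair-affine 2) (pair-affine (pair 1 (pair (pair 0 0) k))))

define₃Code : (k₁ k₂ k₃ : ℕ) → ℕ → ℕ
define₃Code k₁ k₂ k₃ = defineCode k₁ ∘ defineCode k₂ ∘ defineCode k₃

-- The term codes enter through equations because the same three numbers must serve for every `n`.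
codeF-define₃ : ∀ {k₁ k₂ k₃} (t₁ : Term n) (t₂ : Term (1 + n)) (t₃ : Term (2 + n)) →
                codeT (wkT t₁) ≡ k₁ → codeT (wkT t₂) ≡ k₂ → codeT (wkT t₃) ≡ k₃ → ∀ φ →
                codeF (define t₁ (define t₂ (define t₃ φ))) ≡ define₃Code k₁ k₂ k₃ (codeF φ)
codeF-define₃ t₁ t₂ t₃ refl refl refl φ =
  trans (codeF-define t₁ _)
        (cong (defineCode _)
          (trans (codeF-define t₂ _) (cong (defineCode _) (codeF-define t₃ φ))))

define₃Code-affine : ∀ k₁ k₂ k₃ → Affine (define₃Code k₁ k₂ k₃)
define₃Code-affine k₁ k₂ k₃ =
  Affine-∘ (defineCode-affine k₁)
    (Affine-∘ (defineCode-affine k₂) (defineCode-affine k₃))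

-- A variable is coded by its index alone, so enlarging the scope leaves codes unchanged.
codeT-ren : {ρ : Ren n l} → (∀ i → toℕ (ρ i) ≡ toℕ i) → ∀ t → codeT (renT ρ t) ≡ codeT t
codeT-ren e (var i)  rewrite e i = refl
codeT-ren e `0       = refl
codeT-ren e (`S t)   rewrite codeT-ren e t = refl
codeT-ren e (s `+ t) rewrite codeT-ren e s | codeT-ren e t = refl
codeT-ren e (s `* t) rewrite codeT-ren e s | codeT-ren e t = refl

extR-toℕ : {ρ : Ren n l} → (∀ i → toℕ (ρ i) ≡ toℕ i) → ∀ i → toℕ (extR ρ i) ≡ toℕ i
extR-toℕ e zero    = refl
extR-toℕ e (suc i) = cong suc (e i)

codeF-ren : {ρ : Ren n l} → (∀ i → toℕ (ρ i) ≡ toℕ i) → ∀ φ → codeF (renF ρ φ) ≡ codeF φ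
codeF-ren e ⊥'       = refl
codeF-ren e (s == t) rewrite codeT-ren e s | codeT-ren e t = refl
codeF-ren e (φ ⇒ ψ)  rewrite codeF-ren e φ | codeF-ren e ψ = refl
codeF-ren e (∀' φ)   rewrite codeF-ren (extR-toℕ e) φ = refl

-- Layers of definitions

pattern v0 = zero
pattern v1 = suc zero
pattern v2 = suc (suc zero)

-- The state (y, g, d), held in the variables 0, 1, 2, is replaced by the state
-- (y + 1, 1 + (1 + d) g, d).
layer : Formula (6 + n) → Formula (3 + n)
layer φ =
  define (var v2) (define (`S (var v2 `+ (var v0 `* var v2))) (define (`S (var v2)) φ))

-- The new state lies on top of the old one, which stays in scope below it.
next : Sub (3 + n) 0 → Sub (6 + n) 0
next σ = `S (σ v0) ◂ `S (σ v1 `+ (σ v2 `* σ v1)) ◂ σ v2 ◂ σ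

subF-layer-≃ : (σ : Sub (3 + n) 0) (φ : Formula (6 + n)) →
               T ⊢ subF σ (layer φ) ≃ subF (next σ) φ
subF-layer-≃ σ φ =
  ≃-trans (subF-define-≃ σ (var v2) _)
    (≃-trans (subF-define-≃ _ (`S (var v2 `+ (var v0 `* var v2))) _)
             (subF-define-≃ _ (`S (var v2)) φ))

layerCode : ℕ → ℕ
layerCode = define₃Code
  (codeT (var {4} (suc v2)))
  (codeT (`S (var {5} (suc v2) `+ (var v1 `* var (suc v2)))))
  (codeT (`S (var {6} (suc v2))))

codeF-layer : (φ : Formula (6 + n)) → codeF (layer φ) ≡ layerCode (codeF φ)
codeF-layer φ =
  codeF-define₃ (var v2) (`S (var v2 `+ (var v0 `* var v2))) (`S (var v2)) refl refl refl φ

layerCode-affine : Affine layerCode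
layerCode-affine = define₃Code-affine _ _ _

d κ : ℕ
d = slope layerCode-affine
κ = offset layerCode-affine

geo : ℕ → ℕ
geo zero    = 0
geo (suc m) = suc (geo m + d * geo m)

-- The innermost formula is a family in `n` because each layer brings three more variables into
-- scope.
layers : ℕ → (∀ n → Formula (3 + n)) → ∀ n → Formula (3 + n)
layers zero    φ n = φ n
layers (suc m) φ n = layer (layers m φ (3 + n))

-- Note 1 + d · geo m = (1 + d)ᵐ.
layersCode : ℕ → ℕ → ℕ
layersCode g c = suc (d * g) * c + κ * g

-- Iterating the affine map of one layer: `geo m` yields both the power of `suc d` and the
-- accumulated offsets, so the state needs to carry just this one sum.
codeF-layers : {φ : ∀ n → Formula (3 + n)} {c : ℕ} → (∀ n → codeF (φ n) ≡ c) →
               ∀ m n → codeF (layers m φ n) ≡ layersCode (geo m) c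
codeF-layers {φ} {c} e zero n = trans (e n) (base d κ c)
  where
  base : ∀ d κ c → c ≡ suc (d * 0) * c + κ * 0
  base = solve-∀
codeF-layers {φ} {c} e (suc m) n = begin
  codeF (layer (layers m φ (3 + n)))         ≡⟨ codeF-layer _ ⟩
  layerCode (codeF (layers m φ (3 + n)))     ≡⟨ cong layerCode (codeF-layers e m (3 + n)) ⟩
  layerCode (layersCode (geo m) c)           ≡⟨ affine-eq layerCode-affine _ ⟩
  suc d * layersCode (geo m) c + κ           ≡⟨ step d κ (geo m) c ⟩
  layersCode (geo (suc m)) c                 ∎
  where
  open ≡-Reasoning
  step : ∀ d κ g c → suc d * (suc (d * g) * c + κ * g) + κ
                   ≡ suc (d * suc (g + d * g)) * c + κ * suc (g + d * g)
  step = solve-∀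

-- A layer cannot mention the numeral of `d`, which is computed from the layer's own code. The
-- numeral is put into the state here instead, with `g` and `y` starting at 0.
initialise : Formula 3 → Sentence
initialise φ = define (num d) (define `0 (define `0 φ))

initialise-≃ : (φ : Formula 3) →
               T ⊢ initialise φ ≃ subF (`0 ◂ `0 ◂ sub0 (num d)) φ
initialise-≃ φ =
  ≃-trans (define-≃ (num d) _) (≃-trans (subF-define-≃ _ `0 _) (subF-define-≃ _ `0 φ))

initialiseCode : ℕ → ℕ
initialiseCode = define₃Code (codeT (wkT {0} (num d))) (pair 1 0) (pair 1 0)

codeF-initialise : (φ : Formula 3) → codeF (initialise φ) ≡ initialiseCode (codeF φ)
codeF-initialise φ = codeF-define₃ (num d) `0 `0 refl refl refl φ

initialiseCode-affine : Affine initialiseCode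
initialiseCode-affine = define₃Code-affine _ _ _

a b : ℕ
a = slope initialiseCode-affine
b = offset initialiseCode-affine

-- The core and its term for the code of the sentence

codeOf : ℕ → ℕ → ℕ
codeOf g y = suc a * layersCode g y + b

-- The numerals of `a`, `b` and `κ` cause no circularity: they come from the initialisation and the
-- layers, not from the core. The core's own code is read from variable 0.
codeTerm : Term 3
codeTerm =
  (num (suc a) `* ((`S (var v2 `* var v1) `* var v0) `+ (num κ `* var v1))) `+ num b

value-codeTerm : (σ : Sub 3 0) → value (σ v2) ≡ d →
                 value (subT σ codeTerm) ≡ codeOf (value (σ v1)) (value (σ v0))
value-codeTerm σ e
  rewrite value-subT σ codeTerm | eval-num (value ∘ σ) a | eval-num (value ∘ σ) κ
        | eval-num (value ∘ σ) b | e = refl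

core : Formula 1 → ∀ n → Formula (3 + n)
core A n = renF (_↑ˡ n) (define codeTerm (renF (λ _ → zero) A))

codeF-core : (A : Formula 1) (n : ℕ) → codeF (core A n) ≡ codeF (core A 0)
codeF-core A n = trans (codeF-ren (λ i → toℕ-↑ˡ i n) φ) (sym (codeF-ren (λ i → toℕ-↑ˡ i 0) φ))
  where φ = define codeTerm (renF (λ _ → zero) A)

-- The diagonal lemma

module Diagonal (U : Theory) (U⊇R : Extends-R U) (A : Formula 1) where

  core-≃ : (σ : Sub (3 + n) 0) → value (σ v2) ≡ d →
           U ⊢ subF σ (core A n) ≃ A [ num (codeOf (value (σ v1)) (value (σ v0))) ]
  core-≃ {n} σ e =
    subst₂ (U ⊢_≃_)
      (sym (subF-renF σ (_↑ˡ n) _))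
      (cong (λ k → A [ num k ]) (value-codeTerm τ e))
      (≃-trans
        (subst (U ⊢ subF τ (define codeTerm (renF (λ _ → zero) A)) ≃_) instantiate
          (subF-define-≃ τ codeTerm _))
        (leibniz A (==-value U⊇R t)))
    where
    τ : Sub 3 0
    τ = σ ∘ (_↑ˡ n)
    t = subT τ codeTerm
    instantiate : subF (t ◂ τ) (renF (λ _ → zero) A) ≡ A [ t ]
    instantiate = trans (subF-renF _ _ A) (subF-cong (λ { zero → refl }) A)

  -- Invariant: after `i` layers the state has the values `i`, `geo i`, `d`; the remaining `m`
  -- layers bring the counter to `m + i`.
  layers-≃ : ∀ m i (σ : Sub (3 + n) 0) →
             value (σ v0) ≡ i → value (σ v1) ≡ geo i → value (σ v2) ≡ d →
             U ⊢ subF σ (layers m (core A) n) ≃ A [ num (codeOf (geo (m + i)) (m + i)) ]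
  layers-≃ zero i σ e₀ e₁ e₂ =
    subst₂ (λ g y → U ⊢ subF σ (core A _) ≃ A [ num (codeOf g y) ]) e₁ e₀ (core-≃ σ e₂)
  layers-≃ {n} (suc m) i σ e₀ e₁ e₂ =
    ≃-trans (subF-layer-≃ σ _)
      (subst (λ k → U ⊢ subF (next σ) (layers m (core A) (3 + n)) ≃ A [ num (codeOf (geo k) k) ])
        (+-suc m i)
        -- The updated `g` matches the recursion of `geo` by computation.
        (layers-≃ m (suc i) (next σ) (cong suc e₀)
          (cong suc (cong₂ _+_ e₁ (cong₂ _*_ e₂ e₁))) e₂))

  c : ℕ
  c = codeF (core A 0)

  -- With as many layers as the code of the core, the counter ends at `c`, so `codeTerm` evaluates
  -- to the code of `γ` itself.
  γ : Sentence
  γ = initialise (layers c (core A) 0)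

  codeF-γ : codeF γ ≡ codeOf (geo c) c
  codeF-γ = begin
    codeF γ                                         ≡⟨ codeF-initialise _ ⟩
    initialiseCode (codeF (layers c (core A) 0))    ≡⟨ cong initialiseCode (codeF-layers (codeF-core A) c 0) ⟩
    initialiseCode (layersCode (geo c) c)           ≡⟨ affine-eq initialiseCode-affine _ ⟩
    codeOf (geo c) c                                ∎
    where open ≡-Reasoning

  fixed-point : U ⊢ γ ≃ A ⟨ γ ⟩
  fixed-point =
    ≃-trans (initialise-≃ _)
      (subst (λ k → U ⊢ subF _ (layers c (core A) 0) ≃ A [ num k ])
        (trans (cong (λ k → codeOf (geo k) k) (+-identityʳ c)) (sym codeF-γ))
        (layers-≃ c 0 (`0 ◂ `0 ◂ sub0 (num d)) refl refl (eval-num (λ ()) d)))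

diagonal : Extends-R U → (A : Formula 1) → Σ Sentence λ γ → U ⊢ γ ≃ A ⟨ γ ⟩
diagonal {U} r A = γ , fixed-point
  where open Diagonal U r A

-- Refuting extensional Rosser formulas

¬¬refutable : {φ : Sentence} → ¬ Consistent (U +ₜ φ) → ¬ ¬ (U ⊢ ¬' φ)
¬¬refutable inc k = inc λ p → k (refute p)

theorem2p1 : (U : Theory) → Consistent U → Extends-R U →
    ¬ (Σ (Formula 1) λ ρ → Independence U ρ × Extensionality U ρ)
theorem2p1 U con r (ρ , ind , ext) =
  -- Inconsistency yields refutability up to double negation, which suffices because the goal is
  -- absurdity.
  ¬¬refutable ¬con-φ λ ¬φ → ¬¬refutable ¬con-ψ λ ¬ψ →
    -- The chain runs from `ρ ⟨ ⊥' ⟩` through `ρ ⟨ φ ⟩` and `φ` to `⊥'`; the other argument proves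
    -- `ρ ⟨ ⊥' ⟩` from `ρ ⟨ ψ ⟩`.
    con (mp (⇒-trans (∧-elimʳ (ext φ ⊥' (refute-≃⊥ ¬φ))) (⇒-trans (proj₂ φ-fix) ¬φ))
            (mp (∧-elimˡ (ext ψ ⊥' (refute-≃⊥ ¬ψ)))
                (mp axDNE (⇒-trans (proj₂ ψ-fix) ¬ψ))))
  where
  φ = proj₁ (diagonal r ρ)
  φ-fix = proj₂ (diagonal r ρ)
  ψ = proj₁ (diagonal r (¬' ρ))
  ψ-fix = proj₂ (diagonal r (¬' ρ))

  ¬con-φ : ¬ Consistent (U +ₜ φ)
  ¬con-φ c = proj₂ (ind φ c)
    (mp (assume (U +ₜ φ) (¬' (ρ ⟨ φ ⟩)))
        (weaken inj₁ (mp (weaken inj₁ (proj₁ φ-fix)) (assume U φ))))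

  ¬con-ψ : ¬ Consistent (U +ₜ ψ)
  ¬con-ψ c = proj₁ (ind ψ c)
    -- `(¬' ρ) ⟨ ψ ⟩` computes to `¬' (ρ ⟨ ψ ⟩)`.
    (mp (weaken inj₁ (mp (weaken inj₁ (proj₁ ψ-fix)) (assume U ψ)))
        (assume (U +ₜ ψ) (ρ ⟨ ψ ⟩)))
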